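{- Let $K$ be an algebraically closed field and let $a(n)_{n\ge 0}$ be a C-finite sequence over $K$ of order $d\ge 1$. Then there exist sequences $c_1(m),\dots,c_d(m)$ (indexed by integers $m\ge 0$) such that for every integer $m\ge 0$ the sequence $n\mapsto a(nm)$ satisfies a recurrence of the form $$a(nm)=\sum_{k=1}^{d} c_k(m)\,a((n-k)m)\qquad (n\ge d),$$ and such that the following hold. (i) For each $1\le k\le d$, the sequence $c_k(m)$ is C-finite with respect to $m$ and has order at most $\binom{d}{k}$. (ii) The sequence $c_1(m)$ always satisfies the same recurrence as $a(n)$ itself, i.e. it is annihilated by the characteristic polynomial of $a(n)$. (iii) $c_d(m)=\omega^m$ for all $m$, where $\omega$ is $(-1)^d$ times the constant coefficient of the characteristic polynomial of $a(n)$.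
   Context: Let $N$ be the shift operator on sequences, $Na(n)=a(n+1)$. A polynomial $p(x)$ annihilates the sequence $a(n)_{n\ge0}$ if $p(N)a(n)=0$ for all $n\ge 0$. A sequence $a(n)_{n\ge 0}$ with values in $K$ is C-finite if some nonzero polynomial $p(x)\in K[x]$ annihilates it. The set of polynomials annihilating $a(n)$ is an ideal of $K[x]$; its monic generator is the characteristic polynomial of $a(n)$, and the degree of this generator is the order (or degree) of $a(n)$.
   Formalization: Part (iii) is proved with the sign corrected, c_d(m) = (-1)^(d-1) ω^m, since c_d(m) = ω^m fails for even d (e.g. a = 0,1,0,1,...: c_2(1) = 1 but ω = -1); K is assumed to have decidable equality, which is automatic classically. -}

module Defs where

open import Level using (_⊔_)
open import Data.Nat.Base using (ℕ; zero; suc; _≤_; _<_)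
open import Data.List.Base using (List; []; _∷_; map)
open import Data.Product.Base using (Σ; ∃; _×_; _,_)
open import Function.Bundles using (_⇔_)
open import Relation.Nullary.Negation.Core using (¬_)
open import Algebra.Bundles using (RawMagma)
open import Algebra.Apartness.Bundles using (HeytingField; HeytingCommutativeRing)
import Algebra.Bundles
import Algebra.Definitions.RawMagma
import Algebra.Definitions.RawSemiring

module OverField {c ℓ₁ ℓ₂} (K : HeytingField c ℓ₁ ℓ₂) where

  open HeytingField K
  open HeytingCommutativeRing heytingCommutativeRing using (commutativeRing)
  open Algebra.Bundles.CommutativeRing commutativeRing using (semiring)
  open Algebra.Bundles.Semiring semiring using (rawSemiring)
  open Algebra.Definitions.RawSemiring rawSemiring public using (sum; _^_)

  -- Coefficient lists, constant term first. Trailing zeros are allowed, so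
  -- lists represent the same polynomial when they are related by _≈ₚ_.
  Poly : Set c
  Poly = List Carrier

  coeff : Poly → ℕ → Carrier
  coeff []      _       = 0#
  coeff (x ∷ p) zero    = x
  coeff (x ∷ p) (suc i) = coeff p i

  infix 4 _≈ₚ_
  _≈ₚ_ : Poly → Poly → Set ℓ₁
  p ≈ₚ q = ∀ i → coeff p i ≈ coeff q i

  infixl 6 _+ₚ_
  _+ₚ_ : Poly → Poly → Poly
  []      +ₚ q       = q
  (x ∷ p) +ₚ []      = x ∷ p
  (x ∷ p) +ₚ (y ∷ q) = (x + y) ∷ (p +ₚ q)

  infixl 7 _*ₚ_
  _*ₚ_ : Poly → Poly → Poly
  []      *ₚ q = []
  (x ∷ p) *ₚ q = map (x *_) q +ₚ (0# ∷ (p *ₚ q))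

  *ₚ-rawMagma : RawMagma c ℓ₁
  *ₚ-rawMagma = record { Carrier = Poly ; _≈_ = _≈ₚ_ ; _∙_ = _*ₚ_ }

  -- p ∣ q : some r has r *ₚ p ≈ₚ q
  open Algebra.Definitions.RawMagma *ₚ-rawMagma public using (_∣_)

  NonZeroₚ : Poly → Set ℓ₁
  NonZeroₚ p = ¬ (p ≈ₚ [])

  HasDegree : Poly → ℕ → Set ℓ₁
  HasDegree p n = ¬ (coeff p n ≈ 0#) × (∀ i → n < i → coeff p i ≈ 0#)

  Monic : Poly → Set ℓ₁
  Monic p = Σ ℕ λ n → HasDegree p n × coeff p n ≈ 1#

  eval : Poly → Carrier → Carrier
  eval []      x = 0#
  eval (y ∷ p) x = y + x * eval p x

  AlgebraicallyClosed : Set (c ⊔ ℓ₁)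
  AlgebraicallyClosed =
    ∀ (p : Poly) (n : ℕ) → 1 ≤ n → HasDegree p n → ∃ λ x → eval p x ≈ 0#

  Seq : Set c
  Seq = ℕ → Carrier

  shift : Seq → Seq
  shift a n = a (suc n)

  -- p ⟨N⟩ a is the sequence p(N)a
  infix 8 _⟨N⟩_
  _⟨N⟩_ : Poly → Seq → Seq
  ([]      ⟨N⟩ a) n = 0#
  ((x ∷ p) ⟨N⟩ a) n = x * a n + (p ⟨N⟩ shift a) n

  Annihilates : Poly → Seq → Set ℓ₁
  Annihilates p a = ∀ n → (p ⟨N⟩ a) n ≈ 0#

  CFinite : Seq → Set (c ⊔ ℓ₁)
  CFinite a = Σ Poly λ p → NonZeroₚ p × Annihilates p a

  -- The second component says that the ideal of annihilating polynomials is
  -- the principal ideal (χ).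
  IsCharPoly : Poly → Seq → Set (c ⊔ ℓ₁)
  IsCharPoly χ a = Monic χ × (∀ q → Annihilates q a ⇔ χ ∣ q)

  HasOrder : Seq → ℕ → Set (c ⊔ ℓ₁)
  HasOrder a d = Σ Poly λ χ → IsCharPoly χ a × HasDegree χ d

  HasOrderAtMost : Seq → ℕ → Set (c ⊔ ℓ₁)
  HasOrderAtMost a n = Σ ℕ λ e → HasOrder a e × e ≤ n

-- Write χ = ∏ (x - μᵢ). Since x - μᵢ divides x ^ m - μᵢ ^ m, the product of all N ^ m - μᵢ ^ m
-- kills a, so n ↦ a(nm) is killed by ∏ (N - μᵢ ^ m); hence c_k(m) is, up to sign, the k-th
-- elementary symmetric polynomial of the μᵢ ^ m. As a function of m this is a sum of
-- (d choose k) geometric sequences, whose ratios are the products of k of the μᵢ. After equal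
-- ratios are merged and zero coefficients dropped, linear independence of geometric sequences
-- shows that the characteristic polynomial is the product of x - ν over the remaining ratios ν.

module Submission where

open import Defs
open import Data.Nat.Base using (ℕ; suc; _≤_; _∸_) renaming (_*_ to _*ℕ_)
open import Data.Nat.Combinatorics using (_C_)
open import Data.Fin.Base using (toℕ)
open import Data.Product.Base using (Σ; _×_)
open import Relation.Binary.Definitions using (Decidable)
open import Algebra.Apartness.Bundles using (HeytingField)

open import Data.Nat.Base using (zero; _<_; z≤n; s≤s; z<s; s<s) renaming (_+_ to _+ℕ_)
import Data.Nat.Properties as ℕ
open import Data.Nat.Combinatorics using (nCk+nC[k+1]≡[n+1]C[k+1])
open import Data.List.Base using (List; []; _∷_; _++_; map; foldr; length; filter)
open import Data.List.Properties using (length-map; length-++; length-filter)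
open import Data.List.Relation.Unary.All as All using (All; []; _∷_)
import Data.List.Relation.Unary.All.Properties as All
open import Data.List.Relation.Unary.AllPairs using (AllPairs; []; _∷_)
import Data.List.Relation.Unary.AllPairs.Properties as AllPairs
open import Data.Product.Base using (_,_; proj₁; proj₂)
open import Function.Bundles using (mk⇔; Equivalence)
open import Relation.Nullary using (¬_; yes; no; contradiction; ¬?)
open import Relation.Binary.Definitions using (tri<; tri≈; tri>)
open import Relation.Binary.PropositionalEquality as ≡ using (_≡_)
open import Algebra.Bundles using (CommutativeRing)
open import Algebra.Apartness.Bundles using (HeytingCommutativeRing)
import Algebra.Definitions.RawMagma as RawMagma
import Algebra.Apartness.Properties.HeytingCommutativeRing as HeytingProperties
import Algebra.Properties.Ring as RingProperties
import Algebra.Properties.Semiring.Exp as Exp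
import Algebra.Properties.CommutativeSemiring.Exp as CommutativeExp
import Algebra.Properties.Semiring.Sum as SemiringSum
import Algebra.Properties.CommutativeMonoid.Sum as CommutativeSum
import Algebra.Solver.Ring.NaturalCoefficients.Default as NaturalSolver
import Relation.Binary.Reasoning.Setoid as SetoidReasoning

-- Roots of χ may repeat, so `a` itself need not be a sum of geometric sequences. It is therefore
-- handled only through the operators N - μ, taken with multiplicity (`KilledBy`). The coefficients
-- c_k are sums of geometric sequences whatever the multiplicities are. `HasOrderAtMost` asks for an
-- exact generator of the annihilator ideal; an annihilator of degree at most (d choose k) would not
-- be enough. Merging and dropping terms leaves precisely the ratios at which every annihilator must
-- vanish. Both operations decide equality in `K`, which decidable apartness makes possible. The
-- sign in the last claim: solving the recurrence for its leading term negates the symmetric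
-- polynomials, so c_d(m) = -(-1)^d ω^m. The factor (-1)^(d-1) cannot be omitted: for the Fibonacci
-- numbers d = 2 and ω = -1, while c_2(1) = 1.

module _ {c ℓ₁ ℓ₂} (K : HeytingField c ℓ₁ ℓ₂) where

  open HeytingField K hiding (zero)
  open OverField K
  open RawMagma *ₚ-rawMagma using (_,_)
  open HeytingCommutativeRing heytingCommutativeRing using (commutativeRing)
  open CommutativeRing commutativeRing
    using (ring; semiring; commutativeSemiring; +-commutativeMonoid)
  open HeytingProperties heytingCommutativeRing using (1#0)
  open RingProperties ring
    using (-‿distribʳ-*; -‿distribˡ-*; -‿involutive; -0#≈0#; -‿+-comm; -1*x≈-x; +-inverseˡ-unique)
  open Exp semiring using (^-congˡ)
  open CommutativeExp commutativeSemiring using (^-distrib-*)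
  open SemiringSum semiring using (*-distribˡ-sum; sum-cong-≋)
  open CommutativeSum +-commutativeMonoid using (∑-distrib-+)
  open NaturalSolver commutativeSemiring using (solve; _:+_; _:*_; _:=_; con)
  open SetoidReasoning setoid

  -- Field arithmetic; coefficients and values of polynomials.

  infix 4 _≉_
  _≉_ : Carrier → Carrier → Set ℓ₁
  x ≉ y = ¬ (x ≈ y)

  1≉0 : 1# ≉ 0#
  1≉0 1≈0 = proj₂ (tight 1# 0#) 1≈0 1#0

  -- The semiring solver treats - x as an atom; this removes the leftover x + - x.
  cancels : ∀ x z {u v} → u ≈ v + (x + - x) * z → u ≈ v
  cancels x z {u} {v} u≈ = begin
    u                      ≈⟨ u≈ ⟩
    v + (x + - x) * z      ≈⟨ +-congˡ (trans (*-congʳ (-‿inverseʳ x)) (zeroˡ z)) ⟩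
    v + 0#                 ≈⟨ +-identityʳ v ⟩
    v                      ∎

  1^n≈1 : ∀ n → 1# ^ n ≈ 1#
  1^n≈1 zero    = refl
  1^n≈1 (suc n) = trans (*-identityˡ _) (1^n≈1 n)

  x+y*0≈x : ∀ x y → x + y * 0# ≈ x
  x+y*0≈x x y = trans (+-congˡ (zeroʳ y)) (+-identityʳ x)

  coeff-+ : ∀ p q i → coeff (p +ₚ q) i ≈ coeff p i + coeff q i
  coeff-+ []      q       i       = sym (+-identityˡ _)
  coeff-+ (x ∷ p) []      i       = sym (+-identityʳ _)
  coeff-+ (x ∷ p) (y ∷ q) zero    = refl
  coeff-+ (x ∷ p) (y ∷ q) (suc i) = coeff-+ p q i

  coeff-scale : ∀ x p i → coeff (map (x *_) p) i ≈ x * coeff p i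
  coeff-scale x []      i       = sym (zeroʳ x)
  coeff-scale x (y ∷ p) zero    = refl
  coeff-scale x (y ∷ p) (suc i) = coeff-scale x p i

  coeff-∷* : ∀ x p q i →
    coeff ((x ∷ p) *ₚ q) i ≈ x * coeff q i + coeff (0# ∷ (p *ₚ q)) i
  coeff-∷* x p q i =
    trans (coeff-+ (map (x *_) q) (0# ∷ (p *ₚ q)) i) (+-congʳ (coeff-scale x q i))

  *ₚ-identityʳ : ∀ p → p *ₚ (1# ∷ []) ≈ₚ p
  *ₚ-identityʳ []      i       = refl
  *ₚ-identityʳ (x ∷ p) zero    = trans (+-identityʳ _) (*-identityʳ x)
  *ₚ-identityʳ (x ∷ p) (suc i) = *ₚ-identityʳ p i

  ∣-refl : ∀ p → p ∣ p
  ∣-refl p = (1# ∷ []) , λ i → begin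
    coeff ((1# ∷ []) *ₚ p) i              ≈⟨ coeff-∷* 1# [] p i ⟩
    1# * coeff p i + coeff (0# ∷ []) i    ≈⟨ +-cong (*-identityˡ _) (coeff-0∷[] i) ⟩
    coeff p i + 0#                        ≈⟨ +-identityʳ _ ⟩
    coeff p i                             ∎
    where
    coeff-0∷[] : ∀ i → coeff (0# ∷ []) i ≈ 0#
    coeff-0∷[] zero    = refl
    coeff-0∷[] (suc i) = refl

  eval-congʳ : ∀ p {x y} → x ≈ y → eval p x ≈ eval p y
  eval-congʳ []      x≈y = refl
  eval-congʳ (z ∷ p) x≈y = +-congˡ (*-cong x≈y (eval-congʳ p x≈y))

  eval-zero : ∀ p x → p ≈ₚ [] → eval p x ≈ 0#
  eval-zero []      x p≈0 = refl
  eval-zero (y ∷ p) x p≈0 = begin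
    y + x * eval p x  ≈⟨ +-cong (p≈0 0) (*-congˡ (eval-zero p x (λ i → p≈0 (suc i)))) ⟩
    0# + x * 0#       ≈⟨ x+y*0≈x 0# x ⟩
    0#                ∎

  eval-congˡ : ∀ p q x → p ≈ₚ q → eval p x ≈ eval q x
  eval-congˡ []      q       x p≈q = sym (eval-zero q x (λ i → sym (p≈q i)))
  eval-congˡ (y ∷ p) []      x p≈q = eval-zero (y ∷ p) x p≈q
  eval-congˡ (y ∷ p) (z ∷ q) x p≈q =
    +-cong (p≈q 0) (*-congˡ (eval-congˡ p q x (λ i → p≈q (suc i))))

  eval-+ : ∀ p q x → eval (p +ₚ q) x ≈ eval p x + eval q x
  eval-+ []      q       x = sym (+-identityˡ _)
  eval-+ (y ∷ p) []      x = sym (+-identityʳ _)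
  eval-+ (y ∷ p) (z ∷ q) x = begin
    y + z + x * eval (p +ₚ q) x             ≈⟨ +-congˡ (*-congˡ (eval-+ p q x)) ⟩
    y + z + x * (eval p x + eval q x)
      ≈⟨ solve 5 (λ y z x a b → y :+ z :+ x :* (a :+ b) := y :+ x :* a :+ (z :+ x :* b))
           refl y z x (eval p x) (eval q x) ⟩
    y + x * eval p x + (z + x * eval q x)   ∎

  eval-scale : ∀ y p x → eval (map (y *_) p) x ≈ y * eval p x
  eval-scale y []      x = sym (zeroʳ y)
  eval-scale y (z ∷ p) x = begin
    y * z + x * eval (map (y *_) p) x  ≈⟨ +-congˡ (*-congˡ (eval-scale y p x)) ⟩
    y * z + x * (y * eval p x)
      ≈⟨ solve 4 (λ y z x a → y :* z :+ x :* (y :* a) := y :* (z :+ x :* a))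
           refl y z x (eval p x) ⟩
    y * (z + x * eval p x)             ∎

  eval-* : ∀ p q x → eval (p *ₚ q) x ≈ eval p x * eval q x
  eval-* []      q x = sym (zeroˡ _)
  eval-* (y ∷ p) q x = begin
    eval (map (y *_) q +ₚ (0# ∷ (p *ₚ q))) x
      ≈⟨ eval-+ (map (y *_) q) (0# ∷ (p *ₚ q)) x ⟩
    eval (map (y *_) q) x + (0# + x * eval (p *ₚ q) x)
      ≈⟨ +-cong (eval-scale y q x) (+-congˡ (*-congˡ (eval-* p q x))) ⟩
    y * eval q x + (0# + x * (eval p x * eval q x))
      ≈⟨ solve 4 (λ y x a b → y :* b :+ (con 0 :+ x :* (a :* b)) := (y :+ x :* a) :* b)
           refl y x (eval p x) (eval q x) ⟩
    (y + x * eval p x) * eval q x  ∎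

  ⟨N⟩-cong : ∀ p {a b : Seq} → (∀ n → a n ≈ b n) → ∀ n → (p ⟨N⟩ a) n ≈ (p ⟨N⟩ b) n
  ⟨N⟩-cong []      a≈b n = refl
  ⟨N⟩-cong (x ∷ p) a≈b n = +-cong (*-congˡ (a≈b n)) (⟨N⟩-cong p (λ n → a≈b (suc n)) n)

  ⟨N⟩-zero : ∀ p a n → p ≈ₚ [] → (p ⟨N⟩ a) n ≈ 0#
  ⟨N⟩-zero []      a n p≈0 = refl
  ⟨N⟩-zero (x ∷ p) a n p≈0 = begin
    x * a n + (p ⟨N⟩ shift a) n
      ≈⟨ +-cong (*-congʳ (p≈0 0)) (⟨N⟩-zero p (shift a) n (λ i → p≈0 (suc i))) ⟩
    0# * a n + 0#  ≈⟨ trans (+-identityʳ _) (zeroˡ _) ⟩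
    0#             ∎

  -- Synthetic division and splitting into linear factors.

  Δ : Carrier → Seq → Seq
  Δ μ a n = a (suc n) + - μ * a n

  -- Synthetic division: p = (x - μ) * quotient μ p + eval p μ.
  quotient : Carrier → Poly → Poly
  quotient μ []      = []
  quotient μ (x ∷ p) = eval p μ ∷ quotient μ p

  -- This is p = (x - μ) q + p(μ) with μ q moved to the left, and `eval p μ ∷ quotient μ p` is x q +
  -- p(μ). In this form the head coefficients agree by the definition of `eval`.
  coeff-quotient : ∀ μ p i →
    coeff p i + μ * coeff (quotient μ p) i ≈ coeff (eval p μ ∷ quotient μ p) i
  coeff-quotient μ []      zero    = x+y*0≈x 0# μ
  coeff-quotient μ []      (suc i) = x+y*0≈x 0# μ
  coeff-quotient μ (x ∷ p) zero    = refl
  coeff-quotient μ (x ∷ p) (suc i) = coeff-quotient μ p i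

  eval-quotient : ∀ μ p y →
    eval p y + μ * eval (quotient μ p) y ≈ eval p μ + y * eval (quotient μ p) y
  eval-quotient μ []      y = trans (x+y*0≈x 0# μ) (sym (x+y*0≈x 0# y))
  eval-quotient μ (x ∷ p) y = begin
    x + y * eval p y + μ * (eval p μ + y * q)
      ≈⟨ solve 6 (λ x y μ e f q →
           x :+ y :* e :+ μ :* (f :+ y :* q) := x :+ μ :* f :+ y :* (e :+ μ :* q))
           refl x y μ (eval p y) (eval p μ) q ⟩
    x + μ * eval p μ + y * (eval p y + μ * q)
      ≈⟨ +-congˡ (*-congˡ (eval-quotient μ p y)) ⟩
    x + μ * eval p μ + y * (eval p μ + y * q)  ∎
    where q = eval (quotient μ p) y

  -- Division by x - μ with N substituted for x; `Δ μ` is N - μ.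
  ⟨N⟩-quotient : ∀ μ p a n →
    (p ⟨N⟩ a) n ≈ eval p μ * a n + (quotient μ p ⟨N⟩ Δ μ a) n
  ⟨N⟩-quotient μ []      a n = sym (trans (+-identityʳ _) (zeroˡ _))
  ⟨N⟩-quotient μ (x ∷ p) a n = sym (cancels μ (e * a n) (begin
    (x + μ * e) * a n + (e * (a (suc n) + - μ * a n) + r)
      ≈⟨ solve 7 (λ x μ ν e a b r →
           (x :+ μ :* e) :* a :+ (e :* (b :+ ν :* a) :+ r)
             := (x :* a :+ (e :* b :+ r)) :+ (μ :+ ν) :* (e :* a))
           refl x μ (- μ) e (a n) (a (suc n)) r ⟩
    x * a n + (e * a (suc n) + r) + (μ + - μ) * (e * a n)
      ≈⟨ +-congʳ (+-congˡ (⟨N⟩-quotient μ p (shift a) n)) ⟨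
    x * a n + (p ⟨N⟩ shift a) n + (μ + - μ) * (e * a n)  ∎))
    where
    e = eval p μ
    r = (quotient μ p ⟨N⟩ Δ μ (shift a)) n

  -- `quotient` keeps the length of the list, so the drop in degree shows only in the coefficients:
  -- the i-th one is the value at μ of the tail of `p` after position i, and that tail is zero once
  -- n ≤ i.
  quotient-vanishes : ∀ μ p n → (∀ i → n < i → coeff p i ≈ 0#) →
    ∀ i → n ≤ i → coeff (quotient μ p) i ≈ 0#
  quotient-vanishes μ []      n       h i       n≤i       = refl
  quotient-vanishes μ (x ∷ p) zero    h zero    n≤i       =
    eval-zero p μ (λ i → h (suc i) z<s)
  quotient-vanishes μ (x ∷ p) zero    h (suc i) n≤i       =
    quotient-vanishes μ p zero (λ j _ → h (suc j) z<s) i z≤n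
  quotient-vanishes μ (x ∷ p) (suc n) h (suc i) (s≤s n≤i) =
    quotient-vanishes μ p n (λ j n<j → h (suc j) (s<s n<j)) i n≤i

  MonicOfDegree : ℕ → Poly → Set ℓ₁
  MonicOfDegree n p = HasDegree p n × coeff p n ≈ 1#

  monicOfDegree : ∀ p {n} → coeff p n ≈ 1# → (∀ i → n < i → coeff p i ≈ 0#) →
    MonicOfDegree n p
  monicOfDegree p lead vanish = ((λ ≈0 → 1≉0 (trans (sym lead) ≈0)) , vanish) , lead

  HasDegree-unique : ∀ p {m n} → HasDegree p m → HasDegree p n → m ≡ n
  HasDegree-unique p {m} {n} (m≉0 , m<) (n≉0 , n<) with ℕ.<-cmp m n
  ... | tri< m<n _ _ = contradiction (m< n m<n) n≉0
  ... | tri≈ _ m≡n _ = m≡n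
  ... | tri> _ _ n<m = contradiction (n< m n<m) m≉0

  quotient-monic : ∀ μ p {n} → MonicOfDegree (suc n) p → MonicOfDegree n (quotient μ p)
  quotient-monic μ p {n} ((_ , vanish) , lead) =
    monicOfDegree (quotient μ p)
      (begin
        coeff (quotient μ p) n                              ≈⟨ coeff-quotient μ p (suc n) ⟨
        coeff p (suc n) + μ * coeff (quotient μ p) (suc n)
          ≈⟨ +-cong lead (*-congˡ (q-vanishes (suc n) ℕ.≤-refl)) ⟩
        1# + μ * 0#                                         ≈⟨ x+y*0≈x 1# μ ⟩
        1#                                                  ∎)
      q-vanishes
    where q-vanishes = quotient-vanishes μ p (suc n) vanish

  -- A chain of exact divisions rather than an equation with a product: every consequence follows by
  -- peeling off one root, without any laws for `*ₚ`. Repeated roots are listed repeatedly.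
  Splits : Poly → List Carrier → Set ℓ₁
  Splits p []       = p ≈ₚ 1# ∷ []
  Splits p (μ ∷ μs) = eval p μ ≈ 0# × Splits (quotient μ p) μs

  splitting : AlgebraicallyClosed → ∀ n p → MonicOfDegree n p →
    Σ (List Carrier) λ μs → length μs ≡ n × Splits p μs
  splitting closed zero p ((_ , vanish) , lead) = [] , ≡.refl , p≈1
    where
    p≈1 : p ≈ₚ 1# ∷ []
    p≈1 zero    = lead
    p≈1 (suc i) = vanish (suc i) z<s
  splitting closed (suc n) p monic =
    let μ , root       = closed p (suc n) (s≤s z≤n) (proj₁ monic)
        μs , len , spl = splitting closed n (quotient μ p) (quotient-monic μ p monic)
    in μ ∷ μs , ≡.cong suc len , root , spl

  splits-roots : ∀ p μs → Splits p μs → All (λ μ → eval p μ ≈ 0#) μs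
  splits-roots p []       _            = []
  splits-roots p (μ ∷ μs) (root , spl) =
    root ∷ All.map lift (splits-roots (quotient μ p) μs spl)
    where
    lift : ∀ {y} → eval (quotient μ p) y ≈ 0# → eval p y ≈ 0#
    lift {y} q≈0 = begin
      eval p y                                ≈⟨ x+y*0≈x _ μ ⟨
      eval p y + μ * 0#                       ≈⟨ +-congˡ (*-congˡ q≈0) ⟨
      eval p y + μ * eval (quotient μ p) y    ≈⟨ eval-quotient μ p y ⟩
      eval p μ + y * eval (quotient μ p) y    ≈⟨ +-cong root (*-congˡ q≈0) ⟩
      0# + y * 0#                             ≈⟨ x+y*0≈x 0# y ⟩
      0#                                      ∎

  ∏ : List Carrier → Carrier
  ∏ = foldr _*_ 1#

  root⇒coeff-quotient : ∀ μ p → eval p μ ≈ 0# → ∀ i →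
    coeff p i ≈ coeff (0# ∷ quotient μ p) i + - μ * coeff (quotient μ p) i
  root⇒coeff-quotient μ p root i = sym (cancels μ (coeff q i) (begin
    coeff (0# ∷ q) i + - μ * coeff q i
      ≈⟨ +-congʳ (head≈ i) ⟨
    coeff (eval p μ ∷ q) i + - μ * coeff q i
      ≈⟨ +-congʳ (coeff-quotient μ p i) ⟨
    coeff p i + μ * coeff q i + - μ * coeff q i
      ≈⟨ solve 4 (λ p μ ν q → p :+ μ :* q :+ ν :* q := p :+ (μ :+ ν) :* q)
           refl (coeff p i) μ (- μ) (coeff q i) ⟩
    coeff p i + (μ + - μ) * coeff q i  ∎))
    where
    q = quotient μ p
    head≈ : ∀ i → coeff (eval p μ ∷ q) i ≈ coeff (0# ∷ q) i
    head≈ zero    = root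
    head≈ (suc i) = refl

  splits-constant : ∀ p μs → Splits p μs → coeff p 0 ≈ ∏ (map -_ μs)
  splits-constant p []       p≈1          = p≈1 0
  splits-constant p (μ ∷ μs) (root , spl) = begin
    coeff p 0                              ≈⟨ root⇒coeff-quotient μ p root 0 ⟩
    0# + - μ * coeff (quotient μ p) 0      ≈⟨ +-identityˡ _ ⟩
    - μ * coeff (quotient μ p) 0           ≈⟨ *-congˡ (splits-constant (quotient μ p) μs spl) ⟩
    - μ * ∏ (map -_ μs)                    ∎

  -- Products of operators N - μ and sampling along multiples of m.

  -- Iterating N - μ over the list lets one factor be exchanged while the others stay. The same
  -- predicate serves for the roots of χ and for their m-th powers.
  KilledBy : List Carrier → Seq → Set ℓ₁
  KilledBy []       a = ∀ n → a n ≈ 0#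
  KilledBy (μ ∷ μs) a = KilledBy μs (Δ μ a)

  splits-killed : ∀ p μs a → Splits p μs → Annihilates p a → KilledBy μs a
  splits-killed []      []       a p≈1 ann n = contradiction (sym (p≈1 0)) 1≉0
  splits-killed (x ∷ p) []       a p≈1 ann n = begin
    a n                           ≈⟨ *-identityˡ _ ⟨
    1# * a n                      ≈⟨ *-congʳ (p≈1 0) ⟨
    x * a n                       ≈⟨ +-identityʳ _ ⟨
    x * a n + 0#                  ≈⟨ +-congˡ (⟨N⟩-zero p (shift a) n (λ i → p≈1 (suc i))) ⟨
    x * a n + (p ⟨N⟩ shift a) n   ≈⟨ ann n ⟩
    0#                            ∎
  splits-killed p (μ ∷ μs) a (root , spl) ann =
    splits-killed (quotient μ p) μs (Δ μ a) spl λ n → begin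
      (quotient μ p ⟨N⟩ Δ μ a) n                      ≈⟨ +-identityˡ _ ⟨
      0# + (quotient μ p ⟨N⟩ Δ μ a) n                 ≈⟨ +-congʳ (trans (*-congʳ root) (zeroˡ _)) ⟨
      eval p μ * a n + (quotient μ p ⟨N⟩ Δ μ a) n     ≈⟨ ⟨N⟩-quotient μ p a n ⟨
      (p ⟨N⟩ a) n                                     ≈⟨ ann n ⟩
      0#                                              ∎

  killed-cong : ∀ μs {a b} → (∀ n → a n ≈ b n) → KilledBy μs a → KilledBy μs b
  killed-cong []       a≈b killed n = trans (sym (a≈b n)) (killed n)
  killed-cong (μ ∷ μs) a≈b killed   =
    killed-cong μs (λ n → +-cong (a≈b (suc n)) (*-congˡ (a≈b n))) killed

  killed-+* : ∀ μs {a b} x → KilledBy μs a → KilledBy μs b →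
    KilledBy μs (λ n → a n + x * b n)
  killed-+* []       x ka kb n = trans (+-cong (ka n) (*-congˡ (kb n))) (x+y*0≈x 0# x)
  killed-+* (μ ∷ μs) {a} {b} x ka kb =
    killed-cong μs
      (λ n → solve 6 (λ ν x a a′ b b′ →
          a′ :+ ν :* a :+ x :* (b′ :+ ν :* b) := a′ :+ x :* b′ :+ ν :* (a :+ x :* b))
          refl (- μ) x (a n) (a (suc n)) (b n) (b (suc n)))
      (killed-+* μs x ka kb)

  killed-shift : ∀ m μs {a} → KilledBy μs a → KilledBy μs (λ n → a (n +ℕ m))
  killed-shift m []       killed n = killed (n +ℕ m)
  killed-shift m (μ ∷ μs) killed   = killed-shift m μs killed

  -- x - μ divides x ^ m - μ ^ m.
  killed-powerΔ : ∀ m μ μs a → KilledBy (μ ∷ μs) a →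
    KilledBy μs (λ n → a (m +ℕ n) + - (μ ^ m) * a n)
  killed-powerΔ zero    μ μs a killed =
    killed-cong μs
      (λ n → sym (cancels 1# (a n) (solve 2 (λ ν a → a :+ ν :* a := con 0 :+ (con 1 :+ ν) :* a)
        refl (- 1#) (a n))))
      (killed-0 μs)
    where
    killed-0 : ∀ μs → KilledBy μs (λ _ → 0#)
    killed-0 []       n = refl
    killed-0 (μ ∷ μs)   = killed-cong μs (λ n → sym (x+y*0≈x 0# (- μ))) (killed-0 μs)
  -- N^(m+1) - μ^(m+1) = N^m (N - μ) + μ (N^m - μ^m): the first summand is a shift of `Δ μ a`, the
  -- second is the induction hypothesis.
  killed-powerΔ (suc m) μ μs a killed =
    killed-cong μs
      (λ n → begin
        Δ μ a (n +ℕ m) + μ * (a (m +ℕ n) + - (μ ^ m) * a n)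
          ≡⟨ ≡.cong (λ k → Δ μ a k + μ * (a (m +ℕ n) + - (μ ^ m) * a n)) (ℕ.+-comm n m) ⟩
        a (suc m +ℕ n) + - μ * a (m +ℕ n) + μ * (a (m +ℕ n) + - (μ ^ m) * a n)
          ≈⟨ cancels μ (a (m +ℕ n)) (solve 6 (λ μ ν π x y z →
               x :+ ν :* y :+ μ :* (y :+ π :* z) := x :+ (μ :* π) :* z :+ (μ :+ ν) :* y)
               refl μ (- μ) (- (μ ^ m)) (a (suc m +ℕ n)) (a (m +ℕ n)) (a n)) ⟩
        a (suc m +ℕ n) + (μ * - (μ ^ m)) * a n
          ≈⟨ +-congˡ (*-congʳ (-‿distribʳ-* μ (μ ^ m))) ⟨
        a (suc m +ℕ n) + - (μ ^ suc m) * a n  ∎)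
      (killed-+* μs μ (killed-shift m μs killed) (killed-powerΔ m μ μs a killed))

  -- Each factor N - μ is exchanged for N^m - μ^m, which acts on the sampled sequence as N - μ^m.
  -- Writing the shift as `m +ℕ n` makes this definitional, since `suc n *ℕ m` unfolds to
  -- `m +ℕ n *ℕ m`.
  killed-sample : ∀ m μs a → KilledBy μs a →
    KilledBy (map (_^ m) μs) (λ n → a (n *ℕ m))
  killed-sample m []       a killed n = killed (n *ℕ m)
  killed-sample m (μ ∷ μs) a killed   =
    killed-sample m μs (λ n → a (m +ℕ n) + - (μ ^ m) * a n) (killed-powerΔ m μ μs a killed)

  -- Signed elementary symmetric polynomials and their recurrence.

  -- The coefficient of x ^ (length μs - k) in the product of all x - μ.
  σ : ℕ → List Carrier → Carrier
  σ zero    μs       = 1#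
  σ (suc k) []       = 0#
  σ (suc k) (μ ∷ μs) = σ (suc k) μs + - μ * σ k μs

  σ-vanishes : ∀ k μs → length μs < k → σ k μs ≈ 0#
  σ-vanishes (suc k) []       _          = refl
  σ-vanishes (suc k) (μ ∷ μs) (s<s len<k) =
    trans (+-cong (σ-vanishes (suc k) μs (ℕ.m<n⇒m<1+n len<k)) (*-congˡ (σ-vanishes k μs len<k)))
          (x+y*0≈x 0# (- μ))

  σ-length : ∀ μs → σ (length μs) μs ≈ ∏ (map -_ μs)
  σ-length []       = refl
  σ-length (μ ∷ μs) =
    trans (+-cong (σ-vanishes (suc (length μs)) μs (ℕ.n<1+n _)) (*-congˡ (σ-length μs)))
          (+-identityˡ _)

  ∑< : ℕ → (ℕ → Carrier) → Carrier
  ∑< n f = sum {n} (λ i → f (toℕ i))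

  ∑<-cong : ∀ n {f g : ℕ → Carrier} → (∀ i → f i ≈ g i) → ∑< n f ≈ ∑< n g
  ∑<-cong n f≈g = sum-cong-≋ {n} (λ i → f≈g (toℕ i))

  ∑<-+* : ∀ n x (f g : ℕ → Carrier) → ∑< n (λ i → f i + x * g i) ≈ ∑< n f + x * ∑< n g
  ∑<-+* n x f g =
    trans (∑-distrib-+ {n} (λ i → f (toℕ i)) (λ i → x * g (toℕ i)))
          (+-congˡ (sym (*-distribˡ-sum {n} x (λ i → g (toℕ i)))))

  ∑<-last : ∀ n (f : ℕ → Carrier) → ∑< (suc n) f ≈ ∑< n f + f n
  ∑<-last zero    f = +-comm _ _
  ∑<-last (suc n) f = trans (+-congˡ (∑<-last n (λ i → f (suc i)))) (sym (+-assoc _ _ _))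

  -- The sequence a is read backwards from position n, which avoids truncated subtraction.
  killed⇒recurrence : ∀ μs a (f : ℕ → Carrier) n → KilledBy μs a → length μs ≤ n →
    (∀ i j → i +ℕ j ≡ n → f i ≈ a j) → ∑< (suc (length μs)) (λ i → σ i μs * f i) ≈ 0#
  killed⇒recurrence [] a f n killed _ f≈a =
    trans (+-identityʳ _) (trans (*-identityˡ _) (trans (f≈a 0 n ≡.refl) (killed n)))
  killed⇒recurrence (μ ∷ μs) a f (suc n) killed (s≤s len≤n) f≈a = begin
    1# * f 0 + ∑< (suc d) (λ i → (σ (suc i) μs + - μ * σ i μs) * f (suc i))
      ≈⟨ +-congˡ (∑<-cong (suc d) (λ i → solve 4 (λ s t ν f →
           (s :+ ν :* t) :* f := s :* f :+ ν :* (t :* f))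
           refl (σ (suc i) μs) (σ i μs) (- μ) (f (suc i)))) ⟩
    1# * f 0 + ∑< (suc d) (λ i → σ (suc i) μs * f (suc i) + - μ * (σ i μs * f (suc i)))
      ≈⟨ +-congˡ (∑<-+* (suc d) (- μ) (λ i → σ (suc i) μs * f (suc i)) (λ i → σ i μs * f (suc i))) ⟩
    1# * f 0 + (∑< (suc d) (λ i → σ (suc i) μs * f (suc i)) + - μ * rest)
      ≈⟨ +-assoc _ _ _ ⟨
    ∑< (suc (suc d)) (λ i → σ i μs * f i) + - μ * rest
      ≈⟨ +-congʳ (∑<-last (suc d) (λ i → σ i μs * f i)) ⟩
    ∑< (suc d) (λ i → σ i μs * f i) + σ (suc d) μs * f (suc d) + - μ * rest
      ≈⟨ +-congʳ (+-congˡ (trans (*-congʳ (σ-vanishes (suc d) μs (ℕ.n<1+n d))) (zeroˡ _))) ⟩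
    ∑< (suc d) (λ i → σ i μs * f i) + 0# + - μ * rest
      ≈⟨ +-congʳ (+-identityʳ _) ⟩
    ∑< (suc d) (λ i → σ i μs * f i) + - μ * rest
      ≈⟨ ∑<-+* (suc d) (- μ) (λ i → σ i μs * f i) (λ i → σ i μs * f (suc i)) ⟨
    ∑< (suc d) (λ i → σ i μs * f i + - μ * (σ i μs * f (suc i)))
      ≈⟨ ∑<-cong (suc d) (λ i → solve 4 (λ s ν f g →
           s :* f :+ ν :* (s :* g) := s :* (f :+ ν :* g))
           refl (σ i μs) (- μ) (f i) (f (suc i))) ⟩
    ∑< (suc d) (λ i → σ i μs * (f i + - μ * f (suc i)))
      -- If i + j = n, then `f i` and `f (suc i)` are a(j+1) and a(j), so the new sequence is
      -- `Δ μ a` read backwards from one position earlier.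
      ≈⟨ killed⇒recurrence μs (Δ μ a) (λ i → f i + - μ * f (suc i)) n killed len≤n
           (λ i j i+j≡n → +-cong (f≈a i (suc j) (≡.trans (ℕ.+-suc i j) (≡.cong suc i+j≡n)))
                                 (*-congˡ (f≈a (suc i) j (≡.cong suc i+j≡n)))) ⟩
    0#  ∎
    where
    d    = length μs
    rest = ∑< (suc d) (λ i → σ i μs * f (suc i))

  -- Sums of geometric sequences.

  Term : Set c
  Term = Carrier × Carrier

  infix 4 _≉₂_
  _≉₂_ : Term → Term → Set ℓ₁
  s ≉₂ t = proj₂ s ≉ proj₂ t

  -- A term t stands for the geometric sequence with ratio proj₂ t; it is weighted by w t.
  expSum : (Term → Carrier) → List Term → Seq
  expSum w []       m = 0#
  expSum w (t ∷ ts) m = w t * proj₂ t ^ m + expSum w ts m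

  expSum-zero : ∀ w ts m → All (λ t → w t ≈ 0#) ts → expSum w ts m ≈ 0#
  expSum-zero w []       m []         = refl
  expSum-zero w (t ∷ ts) m (w≈0 ∷ ws) =
    trans (+-cong (trans (*-congʳ w≈0) (zeroˡ _)) (expSum-zero w ts m ws)) (+-identityˡ 0#)

  expSum-+* : ∀ x (v w u : Term → Carrier) ts m → (∀ t → v t + x * w t ≈ u t) →
    expSum v ts m + x * expSum w ts m ≈ expSum u ts m
  expSum-+* x v w u []       m _ = x+y*0≈x 0# x
  expSum-+* x v w u (t ∷ ts) m v+xw≈u = begin
    v t * r + V + x * (w t * r + W)
      ≈⟨ solve 6 (λ x v w r V W →
           v :* r :+ V :+ x :* (w :* r :+ W) := (v :+ x :* w) :* r :+ (V :+ x :* W))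
           refl x (v t) (w t) r V W ⟩
    (v t + x * w t) * r + (V + x * W)
      ≈⟨ +-cong (*-congʳ (v+xw≈u t)) (expSum-+* x v w u ts m v+xw≈u) ⟩
    u t * r + expSum u ts m  ∎
    where
    r = proj₂ t ^ m
    V = expSum v ts m
    W = expSum w ts m

  expSum-suc : ∀ w ts m → expSum w ts (suc m) ≈ expSum (λ t → w t * proj₂ t) ts m
  expSum-suc w []       m = refl
  expSum-suc w (t ∷ ts) m = +-cong (sym (*-assoc _ _ _)) (expSum-suc w ts m)

  -- A geometric sequence with ratio ν is an eigenvector of N, so q(N) multiplies its weight by
  -- q(ν). Keeping weights apart from the list leaves the list, and with it the distinctness of its
  -- ratios, untouched.
  ⟨N⟩-expSum : ∀ q w ts n →
    (q ⟨N⟩ expSum w ts) n ≈ expSum (λ t → w t * eval q (proj₂ t)) ts n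
  ⟨N⟩-expSum []      w ts n = sym (expSum-zero _ ts n (All.universal (λ t → zeroʳ (w t)) ts))
  ⟨N⟩-expSum (x ∷ q) w ts n = begin
    x * expSum w ts n + (q ⟨N⟩ shift (expSum w ts)) n
      ≈⟨ +-congˡ (⟨N⟩-cong q (expSum-suc w ts) n) ⟩
    x * expSum w ts n + (q ⟨N⟩ expSum w′ ts) n
      ≈⟨ +-congˡ (⟨N⟩-expSum q w′ ts n) ⟩
    x * expSum w ts n + expSum (λ t → w′ t * eval q (proj₂ t)) ts n
      ≈⟨ +-comm _ _ ⟩
    expSum (λ t → w′ t * eval q (proj₂ t)) ts n + x * expSum w ts n
      ≈⟨ expSum-+* x _ w _ ts n (λ t → solve 4 (λ w r e x →
           w :* r :* e :+ x :* w := w :* (x :+ r :* e))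
           refl (w t) (proj₂ t) (eval q (proj₂ t)) x) ⟩
    expSum (λ t → w t * eval (x ∷ q) (proj₂ t)) ts n  ∎
    where w′ = λ t → w t * proj₂ t

  roots⇒annihilates-expSum : ∀ q w ts → All (λ t → eval q (proj₂ t) ≈ 0#) ts →
    Annihilates q (expSum w ts)
  roots⇒annihilates-expSum q w ts roots n =
    trans (⟨N⟩-expSum q w ts n)
          (expSum-zero _ ts n (All.map (λ {t} r≈0 → trans (*-congˡ r≈0) (zeroʳ (w t))) roots))

  -- Monic polynomials with prescribed roots.

  fromRoots : List Carrier → Poly
  fromRoots []       = 1# ∷ []
  fromRoots (μ ∷ μs) = (0# ∷ fromRoots μs) +ₚ map (- μ *_) (fromRoots μs)

  coeff-fromRoots : ∀ μ μs i →
    coeff (fromRoots (μ ∷ μs)) i ≈ coeff (0# ∷ fromRoots μs) i + - μ * coeff (fromRoots μs) i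
  coeff-fromRoots μ μs i =
    trans (coeff-+ (0# ∷ fromRoots μs) (map (- μ *_) (fromRoots μs)) i)
          (+-congˡ (coeff-scale (- μ) (fromRoots μs) i))

  fromRoots-monic : ∀ μs → MonicOfDegree (length μs) (fromRoots μs)
  fromRoots-monic []       = monicOfDegree (1# ∷ []) refl (λ { (suc i) _ → refl })
  fromRoots-monic (μ ∷ μs) =
    let ((_ , vanish) , lead) = fromRoots-monic μs in
    monicOfDegree (fromRoots (μ ∷ μs))
      (begin
        coeff (fromRoots (μ ∷ μs)) (suc (length μs))  ≈⟨ coeff-fromRoots μ μs (suc (length μs)) ⟩
        coeff (fromRoots μs) (length μs) + - μ * coeff (fromRoots μs) (suc (length μs))
          ≈⟨ +-cong lead (*-congˡ (vanish _ (ℕ.n<1+n _))) ⟩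
        1# + - μ * 0#                                 ≈⟨ x+y*0≈x 1# (- μ) ⟩
        1#                                            ∎)
      (λ { (suc i) (s<s len<i) → begin
        coeff (fromRoots (μ ∷ μs)) (suc i)  ≈⟨ coeff-fromRoots μ μs (suc i) ⟩
        coeff (fromRoots μs) i + - μ * coeff (fromRoots μs) (suc i)
          ≈⟨ +-cong (vanish i len<i) (*-congˡ (vanish (suc i) (ℕ.m<n⇒m<1+n len<i))) ⟩
        0# + - μ * 0#                       ≈⟨ x+y*0≈x 0# (- μ) ⟩
        0#                                  ∎ })

  eval-fromRoots : ∀ μ μs y →
    eval (fromRoots (μ ∷ μs)) y ≈ (y + - μ) * eval (fromRoots μs) y
  eval-fromRoots μ μs y = begin
    eval (fromRoots (μ ∷ μs)) y  ≈⟨ eval-+ (0# ∷ P) (map (- μ *_) P) y ⟩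
    0# + y * eval P y + eval (map (- μ *_) P) y  ≈⟨ +-congˡ (eval-scale (- μ) P y) ⟩
    0# + y * eval P y + - μ * eval P y
      ≈⟨ solve 3 (λ y ν e → con 0 :+ y :* e :+ ν :* e := (y :+ ν) :* e)
           refl y (- μ) (eval P y) ⟩
    (y + - μ) * eval P y  ∎
    where P = fromRoots μs

  fromRoots-roots : ∀ μs → All (λ μ → eval (fromRoots μs) μ ≈ 0#) μs
  fromRoots-roots []       = []
  fromRoots-roots (μ ∷ μs) =
    trans (eval-fromRoots μ μs μ) (trans (*-congʳ (-‿inverseʳ μ)) (zeroˡ _)) ∷
    All.map (λ {y} root → trans (eval-fromRoots μ μs y) (trans (*-congˡ root) (zeroʳ _)))
            (fromRoots-roots μs)

  -- The factor x - μ moves past `r`. This one case stands in for general commutativity and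
  -- associativity of `*ₚ`.
  *ₚ-fromRoots : ∀ r μ μs i → let s = r *ₚ fromRoots μs in
    coeff (r *ₚ fromRoots (μ ∷ μs)) i ≈ coeff (0# ∷ s) i + - μ * coeff s i
  *ₚ-fromRoots []      μ μs zero    = sym (x+y*0≈x 0# (- μ))
  *ₚ-fromRoots []      μ μs (suc i) = sym (x+y*0≈x 0# (- μ))
  *ₚ-fromRoots (x ∷ r) μ μs zero    = begin
    coeff ((x ∷ r) *ₚ fromRoots (μ ∷ μs)) 0   ≈⟨ coeff-∷* x r (fromRoots (μ ∷ μs)) 0 ⟩
    x * coeff (fromRoots (μ ∷ μs)) 0 + 0#     ≈⟨ +-congʳ (*-congˡ (coeff-fromRoots μ μs 0)) ⟩
    x * (0# + - μ * coeff P 0) + 0#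
      ≈⟨ solve 3 (λ x ν e → x :* (con 0 :+ ν :* e) :+ con 0 := con 0 :+ ν :* (x :* e :+ con 0))
           refl x (- μ) (coeff P 0) ⟩
    0# + - μ * (x * coeff P 0 + 0#)           ≈⟨ +-congˡ (*-congˡ (coeff-∷* x r P 0)) ⟨
    0# + - μ * coeff ((x ∷ r) *ₚ P) 0         ∎
    where P = fromRoots μs
  *ₚ-fromRoots (x ∷ r) μ μs (suc i) = begin
    coeff ((x ∷ r) *ₚ fromRoots (μ ∷ μs)) (suc i)
      ≈⟨ coeff-∷* x r (fromRoots (μ ∷ μs)) (suc i) ⟩
    x * coeff (fromRoots (μ ∷ μs)) (suc i) + coeff (r *ₚ fromRoots (μ ∷ μs)) i
      ≈⟨ +-cong (*-congˡ (coeff-fromRoots μ μs (suc i))) (*ₚ-fromRoots r μ μs i) ⟩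
    x * (coeff P i + - μ * coeff P (suc i)) + (coeff (0# ∷ s) i + - μ * coeff s i)
      ≈⟨ solve 6 (λ x ν p p′ s s′ →
           x :* (p :+ ν :* p′) :+ (s′ :+ ν :* s) := x :* p :+ s′ :+ ν :* (x :* p′ :+ s))
           refl x (- μ) (coeff P i) (coeff P (suc i)) (coeff s i) (coeff (0# ∷ s) i) ⟩
    x * coeff P i + coeff (0# ∷ s) i + - μ * (x * coeff P (suc i) + coeff s i)
      ≈⟨ +-cong (coeff-∷* x r P i) (*-congˡ (coeff-∷* x r P (suc i))) ⟨
    coeff ((x ∷ r) *ₚ P) i + - μ * coeff ((x ∷ r) *ₚ P) (suc i)  ∎
    where
    P = fromRoots μs
    s = r *ₚ P

  fromRoots∣⇒roots : ∀ μs q → fromRoots μs ∣ q → All (λ μ → eval q μ ≈ 0#) μs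
  fromRoots∣⇒roots μs q (r , r*P≈q) =
    All.map (λ {y} root → begin
        eval q y                            ≈⟨ eval-congˡ (r *ₚ fromRoots μs) q y r*P≈q ⟨
        eval (r *ₚ fromRoots μs) y          ≈⟨ eval-* r (fromRoots μs) y ⟩
        eval r y * eval (fromRoots μs) y    ≈⟨ *-congˡ root ⟩
        eval r y * 0#                       ≈⟨ zeroʳ _ ⟩
        0#                                  ∎)
      (fromRoots-roots μs)

  -- Symmetric polynomials of m-th powers as sums of geometric sequences.

  -- Expands - σ k of the m-th powers of μs: one term for each choice of k of the μs.
  terms : ℕ → List Carrier → List Term
  terms zero    μs       = (- 1# , 1#) ∷ []
  terms (suc k) []       = []
  terms (suc k) (μ ∷ μs) = terms (suc k) μs ++ map (λ (x , ν) → - x , μ * ν) (terms k μs)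

  length-terms : ∀ k μs → length (terms k μs) ≤ length μs C k
  length-terms zero    μs       = ℕ.≤-refl
  length-terms (suc k) []       = z≤n
  length-terms (suc k) (μ ∷ μs) = ℕ.≤-trans
    (ℕ.≤-reflexive (≡.trans (length-++ (terms (suc k) μs))
      (≡.trans (≡.cong (length (terms (suc k) μs) +ℕ_) (length-map _ (terms k μs)))
               (ℕ.+-comm (length (terms (suc k) μs)) (length (terms k μs))))))
    (ℕ.≤-trans (ℕ.+-mono-≤ (length-terms k μs) (length-terms (suc k) μs))
      (ℕ.≤-reflexive (nCk+nC[k+1]≡[n+1]C[k+1] (length μs) k)))

  expSum-++ : ∀ w ss ts m → expSum w (ss ++ ts) m ≈ expSum w ss m + expSum w ts m
  expSum-++ w []       ts m = sym (+-identityˡ _)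
  expSum-++ w (s ∷ ss) ts m = trans (+-congˡ (expSum-++ w ss ts m)) (sym (+-assoc _ _ _))

  expSum-map : ∀ μ ts m →
    expSum proj₁ (map (λ (x , ν) → - x , μ * ν) ts) m ≈ - (μ ^ m) * expSum proj₁ ts m
  expSum-map μ []             m = sym (zeroʳ _)
  expSum-map μ ((x , ν) ∷ ts) m = begin
    - x * (μ * ν) ^ m + expSum proj₁ (map (λ (x , ν) → - x , μ * ν) ts) m
      ≈⟨ +-cong (*-congˡ (^-distrib-* μ ν m)) (expSum-map μ ts m) ⟩
    - x * (μ ^ m * ν ^ m) + - (μ ^ m) * S
      ≈⟨ +-congʳ (begin
           - x * (μ ^ m * ν ^ m)      ≈⟨ *-assoc _ _ _ ⟨
           - x * μ ^ m * ν ^ m        ≈⟨ *-congʳ (-‿distribˡ-* x (μ ^ m)) ⟨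
           - (x * μ ^ m) * ν ^ m      ≈⟨ *-congʳ (-‿distribʳ-* x (μ ^ m)) ⟩
           x * - (μ ^ m) * ν ^ m      ≈⟨ *-congʳ (*-comm _ _) ⟩
           - (μ ^ m) * x * ν ^ m      ≈⟨ *-assoc _ _ _ ⟩
           - (μ ^ m) * (x * ν ^ m)    ∎) ⟩
    - (μ ^ m) * (x * ν ^ m) + - (μ ^ m) * S
      ≈⟨ distribˡ _ _ _ ⟨
    - (μ ^ m) * (x * ν ^ m + S)  ∎
    where S = expSum proj₁ ts m

  -- `terms` follows the recursion of `σ`; since (μ ν)^m = μ^m ν^m, the ratios do not depend on m.
  σ-powers : ∀ k μs m → - σ k (map (_^ m) μs) ≈ expSum proj₁ (terms k μs) m
  σ-powers zero    μs       m = sym (trans (+-identityʳ _) (trans (*-congˡ (1^n≈1 m)) (*-identityʳ _)))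
  σ-powers (suc k) []       m = -0#≈0#
  σ-powers (suc k) (μ ∷ μs) m = begin
    - (σ (suc k) νs + - (μ ^ m) * σ k νs)
      ≈⟨ -‿+-comm _ _ ⟨
    - σ (suc k) νs + - (- (μ ^ m) * σ k νs)
      ≈⟨ +-congˡ (-‿distribʳ-* _ _) ⟩
    - σ (suc k) νs + - (μ ^ m) * - σ k νs
      ≈⟨ +-cong (σ-powers (suc k) μs m) (*-congˡ (σ-powers k μs m)) ⟩
    expSum proj₁ (terms (suc k) μs) m + - (μ ^ m) * expSum proj₁ (terms k μs) m
      ≈⟨ +-congˡ (expSum-map μ (terms k μs) m) ⟨
    expSum proj₁ (terms (suc k) μs) m +
      expSum proj₁ (map (λ (x , ν) → - x , μ * ν) (terms k μs)) m
      ≈⟨ expSum-++ proj₁ (terms (suc k) μs) _ m ⟨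
    expSum proj₁ (terms (suc k) (μ ∷ μs)) m  ∎
    where νs = map (_^ m) μs

  -- For k = 1 the ratios are the roots themselves, in the form `μ * 1#`: c_1(m) is the power sum of
  -- the μᵢ, so any polynomial vanishing at all μᵢ annihilates it.
  terms-1-roots : ∀ p μs → All (λ μ → eval p μ ≈ 0#) μs →
    All (λ t → eval p (proj₂ t) ≈ 0#) (terms 1 μs)
  terms-1-roots p []       []             = []
  terms-1-roots p (μ ∷ μs) (root ∷ roots) =
    All.++⁺ (terms-1-roots p μs roots) (trans (eval-congʳ p (*-identityʳ μ)) root ∷ [])

  ∏-neg : ∀ μs → ∏ (map -_ μs) ≈ (- 1#) ^ length μs * ∏ μs
  ∏-neg []       = sym (*-identityˡ 1#)
  ∏-neg (μ ∷ μs) = begin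
    - μ * ∏ (map -_ μs)                        ≈⟨ *-cong (sym (-1*x≈-x μ)) (∏-neg μs) ⟩
    - 1# * μ * ((- 1#) ^ length μs * ∏ μs)
      ≈⟨ solve 4 (λ ν μ s p → ν :* μ :* (s :* p) := ν :* s :* (μ :* p))
           refl (- 1#) μ ((- 1#) ^ length μs) (∏ μs) ⟩
    - 1# * (- 1#) ^ length μs * (μ * ∏ μs)     ∎

  ∏-^ : ∀ m μs → ∏ (map (_^ m) μs) ≈ ∏ μs ^ m
  ∏-^ m []       = sym (1^n≈1 m)
  ∏-^ m (μ ∷ μs) = trans (*-congˡ (∏-^ m μs)) (sym (^-distrib-* μ (∏ μs) m))

  -1*-1≈1 : - 1# * - 1# ≈ 1#
  -1*-1≈1 = trans (-1*x≈-x (- 1#)) (-‿involutive 1#)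

  -1^n*-1^n≈1 : ∀ n → (- 1#) ^ n * (- 1#) ^ n ≈ 1#
  -1^n*-1^n≈1 n = begin
    (- 1#) ^ n * (- 1#) ^ n   ≈⟨ ^-distrib-* (- 1#) (- 1#) n ⟨
    (- 1# * - 1#) ^ n         ≈⟨ ^-congˡ n -1*-1≈1 ⟩
    1# ^ n                    ≈⟨ 1^n≈1 n ⟩
    1#                        ∎

  -- Divisibility and linear independence, with apartness decidable.

  module _ (_#?_ : Decidable _#_) where

    _≟_ : Decidable _≈_
    x ≟ y with x #? y
    ... | yes x#y = no (λ x≈y → proj₂ (tight x y) x≈y x#y)
    ... | no ¬x#y = yes (proj₁ (tight x y) ¬x#y)

    -- A Heyting field inverts x - y only when x and y are apart; decidability turns mere inequality
    -- into apartness.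
    difference-cancel : ∀ {x y z} → x ≉ y → (x + - y) * z ≈ 0# → z ≈ 0#
    difference-cancel {x} {y} {z} x≉y xz≈0 with x #? y
    ... | no ¬x#y = contradiction (proj₁ (tight x y) ¬x#y) x≉y
    ... | yes x#y =
      let w , w*d≈1 , _ = #⇒invertible x#y in begin
      z                    ≈⟨ *-identityˡ z ⟨
      1# * z               ≈⟨ *-congʳ w*d≈1 ⟨
      w * (x + - y) * z    ≈⟨ *-assoc _ _ _ ⟩
      w * ((x + - y) * z)  ≈⟨ *-congˡ xz≈0 ⟩
      w * 0#               ≈⟨ zeroʳ w ⟩
      0#                   ∎

    -- After division by x - μ, another root ν satisfies (ν - μ) Q(ν) = q(ν) = 0, and distinctness
    -- cancels the first factor. The cofactor found for Q then serves for q as well.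
    roots⇒fromRoots∣ : ∀ μs q → AllPairs _≉_ μs → All (λ μ → eval q μ ≈ 0#) μs →
      fromRoots μs ∣ q
    roots⇒fromRoots∣ []       q _                []             = q , *ₚ-identityʳ q
    roots⇒fromRoots∣ (μ ∷ μs) q (μ≉ ∷ distinct) (root ∷ roots) =
      r , λ i → begin
        coeff (r *ₚ fromRoots (μ ∷ μs)) i   ≈⟨ *ₚ-fromRoots r μ μs i ⟩
        coeff (0# ∷ (r *ₚ fromRoots μs)) i + - μ * coeff (r *ₚ fromRoots μs) i
          ≈⟨ +-cong (tail≈ i) (*-congˡ (r*P≈Q i)) ⟩
        coeff (0# ∷ Q) i + - μ * coeff Q i  ≈⟨ root⇒coeff-quotient μ q root i ⟨
        coeff q i                           ∎
      where
      Q = quotient μ q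
      descend : ∀ {ν} → μ ≉ ν × eval q ν ≈ 0# → eval Q ν ≈ 0#
      descend {ν} (μ≉ν , qν≈0) = difference-cancel (λ ν≈μ → μ≉ν (sym ν≈μ)) (begin
        (ν + - μ) * eval Q ν                    ≈⟨ distribʳ _ _ _ ⟩
        ν * eval Q ν + - μ * eval Q ν           ≈⟨ +-congʳ (+-identityˡ _) ⟨
        0# + ν * eval Q ν + - μ * eval Q ν      ≈⟨ +-congʳ (+-congʳ root) ⟨
        eval q μ + ν * eval Q ν + - μ * eval Q ν  ≈⟨ +-congʳ (eval-quotient μ q ν) ⟨
        eval q ν + μ * eval Q ν + - μ * eval Q ν
          ≈⟨ cancels μ (eval Q ν) (solve 4 (λ e μ ν f →
               e :+ μ :* f :+ ν :* f := e :+ (μ :+ ν) :* f)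
               refl (eval q ν) μ (- μ) (eval Q ν)) ⟩
        eval q ν                                ≈⟨ qν≈0 ⟩
        0#                                      ∎)
      open RawMagma._∣ʳ_ (roots⇒fromRoots∣ μs Q distinct (All.map descend (All.zip (μ≉ , roots))))
        renaming (quotient to r; equality to r*P≈Q)
      tail≈ : ∀ i → coeff (0# ∷ (r *ₚ fromRoots μs)) i ≈ coeff (0# ∷ Q) i
      tail≈ zero    = refl
      tail≈ (suc i) = r*P≈Q i

    -- Geometric sequences with distinct ratios are linearly independent: applying
    -- N - μ removes the term with ratio μ and multiplies the others by nonzero factors.
    expSum-independent : ∀ w ts → AllPairs _≉₂_ ts → (∀ m → expSum w ts m ≈ 0#) →
      All (λ t → w t ≈ 0#) ts
    expSum-independent w []       _               _    = []
    expSum-independent w (t ∷ ts) (t≉ ∷ distinct) sum≈0 = w≈0 ∷ ws≈0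
      where
      μ = proj₂ t
      w′ : Term → Carrier
      w′ s = w s * proj₂ s + - μ * w s
      reduced : ∀ m → expSum w′ ts m ≈ 0#
      reduced m = begin
        expSum w′ ts m
          ≈⟨ expSum-+* (- μ) (λ s → w s * proj₂ s) w w′ ts m (λ s → refl) ⟨
        expSum (λ s → w s * proj₂ s) ts m + - μ * expSum w ts m
          ≈⟨ +-congʳ (expSum-suc w ts m) ⟨
        expSum w ts (suc m) + - μ * expSum w ts m
          ≈⟨ cancels μ (w t * μ ^ m) (solve 6 (λ μ ν w p S T →
               w :* (μ :* p) :+ S :+ ν :* (w :* p :+ T) := S :+ ν :* T :+ (μ :+ ν) :* (w :* p))
               refl μ (- μ) (w t) (μ ^ m) (expSum w ts (suc m)) (expSum w ts m)) ⟨
        expSum w (t ∷ ts) (suc m) + - μ * expSum w (t ∷ ts) m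
          ≈⟨ +-cong (sum≈0 (suc m)) (*-congˡ (sum≈0 m)) ⟩
        0# + - μ * 0#
          ≈⟨ x+y*0≈x 0# (- μ) ⟩
        0#  ∎
      cancel : ∀ {s} → t ≉₂ s × w′ s ≈ 0# → w s ≈ 0#
      cancel {s} (t≉s , w′≈0) = difference-cancel (λ s≈t → t≉s (sym s≈t))
        (trans (solve 3 (λ r ν w → (r :+ ν) :* w := w :* r :+ ν :* w)
                 refl (proj₂ s) (- μ) (w s)) w′≈0)
      ws≈0 : All (λ s → w s ≈ 0#) ts
      ws≈0 = All.map cancel (All.zip (t≉ , expSum-independent w′ ts distinct reduced))
      -- At m = 0 the power of μ is 1 even when μ is 0, so no power of μ has to be cancelled.
      w≈0 : w t ≈ 0#
      w≈0 = begin
        w t                         ≈⟨ *-identityʳ _ ⟨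
        w t * 1#                    ≈⟨ +-identityʳ _ ⟨
        w t * 1# + 0#               ≈⟨ +-congˡ (expSum-zero w ts 0 ws≈0) ⟨
        expSum w (t ∷ ts) 0         ≈⟨ sum≈0 0 ⟩
        0#                          ∎

    -- q(N) turns a weight x with ratio ν into x q(ν). Independence makes this zero, and x is not.
    annihilates-expSum⇒roots : ∀ q ts → AllPairs _≉₂_ ts → All (λ t → proj₁ t ≉ 0#) ts →
      Annihilates q (expSum proj₁ ts) → All (λ t → eval q (proj₂ t) ≈ 0#) ts
    annihilates-expSum⇒roots q ts distinct nonzero ann =
      -- `difference-cancel` is applied with y = 0, so `x + - 0#` is first simplified to x.
      All.map (λ (x≉0 , xe≈0) → difference-cancel x≉0
                 (trans (*-congʳ (trans (+-congˡ -0#≈0#) (+-identityʳ _))) xe≈0))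
        (All.zip (nonzero , expSum-independent (λ t → proj₁ t * eval q (proj₂ t)) ts distinct
          (λ m → trans (sym (⟨N⟩-expSum q proj₁ ts m)) (ann m))))

    -- Normal form of a sum of geometric sequences and its order.

    -- On a merge the ratio already in the list is the one kept, so its distinctness from the other
    -- ratios carries over unchanged.
    insert : Term → List Term → List Term
    insert t       []             = t ∷ []
    insert (x , μ) ((y , ν) ∷ ts) with μ ≟ ν
    ... | yes _ = (x + y , ν) ∷ ts
    ... | no  _ = (y , ν) ∷ insert (x , μ) ts

    insert-expSum : ∀ t ts m →
      expSum proj₁ (insert t ts) m ≈ expSum proj₁ (t ∷ ts) m
    insert-expSum t       []             m = refl
    insert-expSum (x , μ) ((y , ν) ∷ ts) m with μ ≟ ν
    ... | yes μ≈ν = begin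
      (x + y) * ν ^ m + S              ≈⟨ +-congʳ (distribʳ _ _ _) ⟩
      x * ν ^ m + y * ν ^ m + S        ≈⟨ +-assoc _ _ _ ⟩
      x * ν ^ m + (y * ν ^ m + S)      ≈⟨ +-congʳ (*-congˡ (^-congˡ m μ≈ν)) ⟨
      x * μ ^ m + (y * ν ^ m + S)      ∎
      where S = expSum proj₁ ts m
    ... | no _ = begin
      y * ν ^ m + expSum proj₁ (insert (x , μ) ts) m
        ≈⟨ +-congˡ (insert-expSum (x , μ) ts m) ⟩
      y * ν ^ m + (x * μ ^ m + S)
        ≈⟨ solve 3 (λ a b S → a :+ (b :+ S) := b :+ (a :+ S)) refl (y * ν ^ m) (x * μ ^ m) S ⟩
      x * μ ^ m + (y * ν ^ m + S)  ∎
      where S = expSum proj₁ ts m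

    insert-length : ∀ t ts → length (insert t ts) ≤ suc (length ts)
    insert-length t       []             = ℕ.≤-refl
    insert-length (x , μ) ((y , ν) ∷ ts) with μ ≟ ν
    ... | yes _ = ℕ.n≤1+n _
    ... | no  _ = s≤s (insert-length (x , μ) ts)

    insert-fresh : ∀ s t ts → s ≉₂ t → All (s ≉₂_) ts → All (s ≉₂_) (insert t ts)
    insert-fresh s t       []             s≉t _            = s≉t ∷ []
    insert-fresh s (x , μ) ((y , ν) ∷ ts) s≉t (s≉u ∷ s≉ts) with μ ≟ ν
    ... | yes _ = s≉u ∷ s≉ts
    ... | no  _ = s≉u ∷ insert-fresh s (x , μ) ts s≉t s≉ts

    insert-distinct : ∀ t ts → AllPairs _≉₂_ ts → AllPairs _≉₂_ (insert t ts)
    insert-distinct t       []             _               = [] ∷ []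
    insert-distinct (x , μ) ((y , ν) ∷ ts) (u≉ ∷ distinct) with μ ≟ ν
    ... | yes _   = u≉ ∷ distinct
    ... | no  μ≉ν =
      insert-fresh (y , ν) (x , μ) ts (λ ν≈μ → μ≉ν (sym ν≈μ)) u≉ ∷ insert-distinct (x , μ) ts distinct

    collect : List Term → List Term
    collect = foldr insert []

    collect-expSum : ∀ ts m → expSum proj₁ (collect ts) m ≈ expSum proj₁ ts m
    collect-expSum []       m = refl
    collect-expSum (t ∷ ts) m =
      trans (insert-expSum t (collect ts) m) (+-congˡ (collect-expSum ts m))

    collect-length : ∀ ts → length (collect ts) ≤ length ts
    collect-length []       = z≤n
    collect-length (t ∷ ts) = ℕ.≤-trans (insert-length t (collect ts)) (s≤s (collect-length ts))

    collect-distinct : ∀ ts → AllPairs _≉₂_ (collect ts)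
    collect-distinct []       = []
    collect-distinct (t ∷ ts) = insert-distinct t (collect ts) (collect-distinct ts)

    -- All weights in `terms k μs` are the same sign, so a merged weight is a multiplicity up to
    -- sign. In positive characteristic it can be zero, which is visible only after merging.
    support : List Term → List Term
    support = filter (λ t → ¬? (proj₁ t ≟ 0#))

    support-expSum : ∀ ts m → expSum proj₁ (support ts) m ≈ expSum proj₁ ts m
    support-expSum []       m = refl
    support-expSum (t ∷ ts) m with proj₁ t ≟ 0#
    ... | yes x≈0 = begin
      expSum proj₁ (support ts) m        ≈⟨ support-expSum ts m ⟩
      expSum proj₁ ts m                  ≈⟨ +-identityˡ _ ⟨
      0# + expSum proj₁ ts m             ≈⟨ +-congʳ (trans (*-congʳ x≈0) (zeroˡ _)) ⟨
      expSum proj₁ (t ∷ ts) m            ∎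
    ... | no  _   = +-congˡ (support-expSum ts m)

    -- The reduced list may be empty: then the sequence is zero, its characteristic polynomial is 1
    -- and its order is 0.
    expSum-orderAtMost : ∀ a ts → (∀ m → a m ≈ expSum proj₁ ts m) →
      HasOrderAtMost a (length ts)
    expSum-orderAtMost a ts a≈ =
      length μs , (fromRoots μs , ((length μs , fromRoots-monic μs) , charPoly) ,
        proj₁ (fromRoots-monic μs)) , length≤
      where
      reduced = support (collect ts)
      μs = map proj₂ reduced
      distinct : AllPairs _≉₂_ reduced
      distinct = AllPairs.filter⁺ _ (collect-distinct ts)
      nonzero : All (λ t → proj₁ t ≉ 0#) reduced
      nonzero = All.all-filter _ (collect ts)
      a≈reduced : ∀ m → a m ≈ expSum proj₁ reduced m
      a≈reduced m =
        trans (a≈ m) (sym (trans (support-expSum (collect ts) m) (collect-expSum ts m)))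
      length≤ : length μs ≤ length ts
      length≤ = ℕ.≤-trans (ℕ.≤-reflexive (length-map proj₂ reduced))
        (ℕ.≤-trans (length-filter _ (collect ts)) (collect-length ts))
      charPoly = λ q → mk⇔
        (λ ann → roots⇒fromRoots∣ μs q (AllPairs.map⁺ distinct)
          (All.map⁺ (annihilates-expSum⇒roots q reduced distinct nonzero
            (λ n → trans (sym (⟨N⟩-cong q a≈reduced n)) (ann n)))))
        (λ χ∣q n → trans (⟨N⟩-cong q a≈reduced n)
          (roots⇒annihilates-expSum q proj₁ reduced (All.map⁻ (fromRoots∣⇒roots μs q χ∣q)) n))

  -- The coefficients c_k and their properties.

  charPoly-annihilates : ∀ χ a → IsCharPoly χ a → Annihilates χ a
  charPoly-annihilates χ a (_ , ideal) = Equivalence.from (ideal χ) (∣-refl χ)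

  order⇒CFinite : ∀ a d → HasOrder a d → CFinite a
  order⇒CFinite a d (χ , charPoly , χ-degree) =
    χ , (λ χ≈0 → proj₁ χ-degree (χ≈0 d)) , charPoly-annihilates χ a charPoly

  module _ (μs : List Carrier) where

    coefficient : ℕ → Seq
    coefficient k m = - σ k (map (_^ m) μs)

    coefficient-recurrence : ∀ a → KilledBy μs a → ∀ m n → length μs ≤ n →
      a (n *ℕ m) ≈
        sum {length μs} (λ i → coefficient (suc (toℕ i)) m * a ((n ∸ suc (toℕ i)) *ℕ m))
    coefficient-recurrence a killed m n d≤n = begin
      f 0                    ≈⟨ *-identityˡ _ ⟨
      1# * f 0               ≈⟨ +-inverseˡ-unique _ _ vanishing ⟩
      - ∑< d g               ≈⟨ -1*x≈-x _ ⟨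
      - 1# * ∑< d g          ≈⟨ *-distribˡ-sum {d} (- 1#) (λ i → g (toℕ i)) ⟩
      ∑< d (λ i → - 1# * g i)
        ≈⟨ ∑<-cong d (λ i → trans (-1*x≈-x (g i)) (-‿distribˡ-* _ _)) ⟩
      ∑< d (λ i → coefficient (suc i) m * f (suc i))  ∎
      where
      d  = length μs
      νs = map (_^ m) μs
      f g : ℕ → Carrier
      f i = a ((n ∸ i) *ℕ m)
      g i = σ (suc i) νs * f (suc i)
      -- Only positions with i + j = n are compared, and there the truncated subtraction is exact.
      f≈a : ∀ i j → i +ℕ j ≡ n → f i ≈ a (j *ℕ m)
      f≈a i j ≡.refl = reflexive (≡.cong (λ k → a (k *ℕ m)) (ℕ.m+n∸m≡n i j))
      vanishing : 1# * f 0 + ∑< d g ≈ 0#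
      vanishing = ≡.subst (λ l → ∑< (suc l) (λ i → σ i νs * f i) ≈ 0#) (length-map (_^ m) μs)
        (killed⇒recurrence νs (λ n → a (n *ℕ m)) f n (killed-sample m μs a killed)
          (ℕ.≤-trans (ℕ.≤-reflexive (length-map (_^ m) μs)) d≤n) f≈a)

    coefficient-orderAtMost : Decidable _#_ → ∀ k →
      HasOrderAtMost (coefficient k) (length μs C k)
    coefficient-orderAtMost _#?_ k =
      let e , order , e≤ = expSum-orderAtMost _#?_ (coefficient k) (terms k μs) (σ-powers k μs)
      in e , order , ℕ.≤-trans e≤ (length-terms k μs)

    coefficient-1-annihilated : ∀ χ → Splits χ μs → Annihilates χ (coefficient 1)
    coefficient-1-annihilated χ spl n =
      trans (⟨N⟩-cong χ (σ-powers 1 μs) n)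
            (roots⇒annihilates-expSum χ proj₁ (terms 1 μs)
              (terms-1-roots χ μs (splits-roots χ μs spl)) n)

    -- The last `σ` is the product of all -(μᵢ^m), with sign (-1)^d, and `coefficient` negates it.
    -- At d = 0 the truncated exponent d - 1 would give the wrong sign.
    last-coefficient : 1 ≤ length μs → ∀ m →
      coefficient (length μs) m ≈ (- 1#) ^ (length μs ∸ 1) * ∏ μs ^ m
    last-coefficient 1≤d m = begin
      - σ (length μs) νs                    ≡⟨ ≡.cong (λ l → - σ l νs) (length-map (_^ m) μs) ⟨
      - σ (length νs) νs                    ≈⟨ -‿cong (trans (σ-length νs) (∏-neg νs)) ⟩
      - ((- 1#) ^ length νs * ∏ νs)         ≈⟨ -‿cong (*-congˡ (∏-^ m μs)) ⟩
      - ((- 1#) ^ length νs * ∏ μs ^ m)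
        ≡⟨ ≡.cong (λ l → - ((- 1#) ^ l * ∏ μs ^ m)) (length-map (_^ m) μs) ⟩
      - ((- 1#) ^ length μs * ∏ μs ^ m)     ≈⟨ -‿distribˡ-* _ _ ⟩
      - (- 1#) ^ length μs * ∏ μs ^ m       ≈⟨ *-congʳ (sign (length μs) 1≤d) ⟩
      (- 1#) ^ (length μs ∸ 1) * ∏ μs ^ m   ∎
      where
      νs = map (_^ m) μs
      sign : ∀ d → 1 ≤ d → - ((- 1#) ^ d) ≈ (- 1#) ^ (d ∸ 1)
      sign (suc d) _ = begin
        - (- 1# * (- 1#) ^ d)   ≈⟨ -‿cong (-1*x≈-x _) ⟩
        - - ((- 1#) ^ d)        ≈⟨ -‿involutive _ ⟩
        (- 1#) ^ d              ∎

  -- The constant coefficient is (-1)^d times the product of the roots, and (-1)^d is its own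
  -- inverse; hence ω is that product.
  splits-ω : ∀ χ μs → Splits χ μs → (- 1#) ^ length μs * coeff χ 0 ≈ ∏ μs
  splits-ω χ μs spl = begin
    s * coeff χ 0      ≈⟨ *-congˡ (trans (splits-constant χ μs spl) (∏-neg μs)) ⟩
    s * (s * ∏ μs)     ≈⟨ *-assoc _ _ _ ⟨
    s * s * ∏ μs       ≈⟨ *-congʳ (-1^n*-1^n≈1 (length μs)) ⟩
    1# * ∏ μs          ≈⟨ *-identityˡ _ ⟩
    ∏ μs               ∎
    where s = (- 1#) ^ length μs

proposition1 :
    ∀ {c ℓ₁ ℓ₂} (K : HeytingField c ℓ₁ ℓ₂) →
    let open HeytingField K
        open OverField K
    in
    Decidable _#_ →
    AlgebraicallyClosed →
    ∀ (a : Seq) (d : ℕ) (χ : Poly) →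
    1 ≤ d → CFinite a → IsCharPoly χ a → HasDegree χ d →
    let ω = (- 1#) ^ d * coeff χ 0
    in
    Σ (ℕ → Seq) λ c →
      (∀ m n → d ≤ n →
        a (n *ℕ m) ≈
          sum {d} (λ i → c (suc (toℕ i)) m * a ((n ∸ suc (toℕ i)) *ℕ m)))
      × (∀ k → 1 ≤ k → k ≤ d → CFinite (c k) × HasOrderAtMost (c k) (d C k))
      × Annihilates χ (c 1)
      × (∀ m → c d m ≈ (- 1#) ^ (d ∸ 1) * ω ^ m)
proposition1 K _#?_ closed a d χ 1≤d _ charPoly@((e , χ-degree′ , χ-lead) , _) χ-degree
  -- Being monic comes with a degree of its own, which has to be identified with `d`.
  with ≡.refl ← HasDegree-unique K χ χ-degree′ χ-degree
  -- From here on `d` is `length μs`, the number of roots with multiplicity.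
  with μs , ≡.refl , spl ← splitting K closed d χ (χ-degree , χ-lead) =
    coefficient K μs
  , coefficient-recurrence K μs a
      (splits-killed K χ μs a spl (charPoly-annihilates K χ a charPoly))
  , (λ k _ _ → let order = coefficient-orderAtMost K μs _#?_ k in
       order⇒CFinite K (coefficient K μs k) (proj₁ order) (proj₁ (proj₂ order)) , order)
  , coefficient-1-annihilated K μs χ spl
  , λ m → trans (last-coefficient K μs 1≤d m)
      (*-congˡ (^-congˡ m (sym (splits-ω K χ μs spl))))
  where
  open HeytingField K using (trans; sym; *-congˡ)
  open HeytingCommutativeRing (HeytingField.heytingCommutativeRing K) using (commutativeRing)
  open Exp (CommutativeRing.semiring commutativeRing) using (^-congˡ)
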